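{- There exists a feral family $\mathcal F$ of graphs such that every graph in $\mathcal F$ is $100$-creature-free.
   Context: All graphs are finite, simple and undirected. $N_G(X)$ denotes the open neighborhood of a vertex set $X$. Two disjoint vertex sets are anti-complete if there is no edge between them. Minimal separator of $G$: a non-empty $S\subseteq V(G)$ such that $G-S$ has at least two distinct connected components $L,R$ with $N_G(L)=N_G(R)=S$. A family $\mathcal F$ is feral if there is a constant $c>1$ such that for all natural numbers $N$ there is $G\in\mathcal F$ with $|V(G)|=n>N$ and at least $c^n$ minimal separators. $k$-creature: a tuple $(A,B,\{x_1,\dots,x_k\},\{y_1,\dots,y_k\})$ of mutually disjoint vertex subsets of $V(G)$ (with the $x_i$ distinct and the $y_i$ distinct) such that (i) $G[A]$ and $G[B]$ are connected and $A$ is anti-complete with $B$; (ii) for every $i$, $x_iy_i\in E(G)$, $x_i$ has a neighbor in $A$ and no neighbor in $B$, and $y_i$ has a neighbor in $B$ and no neighbor in $A$; (iii) for $i\ne j$, $x_iy_j\notin E(G)$. $G$ is $k$-creature-free if it contains no $k$-creature. -}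

module Defs where

open import Algebra.Definitions.RawSemiring using ()
open import Data.Bool.Base using (Bool; T)
open import Data.Fin.Base using (Fin)
open import Data.Fin.Subset using (Subset; _∈_; _∉_; _⊆_; Nonempty)
open import Data.Integer.Base using (+_)
open import Data.Nat.Base as ℕ using (ℕ)
open import Data.Product.Base using (_×_; ∃-syntax)
open import Data.Rational.Base as ℚ using (1ℚ; _/_; +-*-rawSemiring)
open import Function.Definitions using (Injective)
open import Level using (0ℓ)
open import Relation.Binary.Construct.Closure.ReflexiveTransitive using (Star)
open import Relation.Binary.Core using (Rel)
open import Relation.Binary.Definitions using (Symmetric)
open import Relation.Binary.PropositionalEquality.Core using (_≡_; _≢_)
open import Relation.Nullary.Negation.Core using (¬_)
open import Relation.Unary using (Pred; _≐_)

open Algebra.Definitions.RawSemiring +-*-rawSemiring public using (_^_)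

-- Adjacency is Bool-valued so that it is decidable and Graph lives in Set.
record Graph : Set where
  field
    order   : ℕ
    adj     : Fin order → Fin order → Bool

  Vertex : Set
  Vertex = Fin order

  VertexSet : Set
  VertexSet = Subset order

  Adj : Rel Vertex 0ℓ
  Adj u v = T (adj u v)

  field
    adj-sym    : Symmetric Adj
    adj-irrefl : ∀ v → ¬ Adj v v

module _ (G : Graph) where
  open Graph G

  N : VertexSet → Pred Vertex 0ℓ
  N X v = v ∉ X × (∃[ u ] u ∈ X × Adj u v)

  HasNeighborIn : Vertex → VertexSet → Set
  HasNeighborIn v X = ∃[ u ] u ∈ X × Adj v u

  Disjoint : VertexSet → VertexSet → Set
  Disjoint X Y = ∀ v → v ∈ X → v ∉ Y

  AntiComplete : VertexSet → VertexSet → Set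
  AntiComplete X Y = ∀ u v → u ∈ X → v ∈ Y → ¬ Adj u v

  InducedAdj : VertexSet → Rel Vertex 0ℓ
  InducedAdj X u v = u ∈ X × v ∈ X × Adj u v

  -- G[X] is connected; the empty graph does not count as connected.
  Connected : VertexSet → Set
  Connected X = Nonempty X × (∀ u v → u ∈ X → v ∈ X → Star (InducedAdj X) u v)

  -- C is the vertex set of a connected component of G - S, i.e. a maximal
  -- vertex set disjoint from S that induces a connected subgraph.
  record IsComponentOfComplement (S C : VertexSet) : Set where
    field
      avoids    : Disjoint C S
      connected : Connected C
      maximal   : ∀ D → Disjoint D S → Connected D → C ⊆ D → D ⊆ C

  record IsMinimalSeparator (S : VertexSet) : Set where
    field
      nonempty    : Nonempty S
      L R         : VertexSet
      L-component : IsComponentOfComplement S L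
      R-component : IsComponentOfComplement S R
      L≢R         : L ≢ R
      N[L]≐S      : N L ≐ (_∈ S)
      N[R]≐S      : N R ≐ (_∈ S)

  AtLeastMinimalSeparators : ℕ → Set
  AtLeastMinimalSeparators m =
    ∃[ f ] Injective {A = Fin m} {B = VertexSet} _≡_ _≡_ f
         × (∀ i → IsMinimalSeparator (f i))

  record Creature (k : ℕ) : Set where
    field
      A B : VertexSet
      x y : Fin k → Vertex

      x-injective : Injective _≡_ _≡_ x
      y-injective : Injective _≡_ _≡_ y

      A-B-disjoint : Disjoint A B
      x∉A : ∀ i → x i ∉ A
      x∉B : ∀ i → x i ∉ B
      y∉A : ∀ i → y i ∉ A
      y∉B : ∀ i → y i ∉ B
      x≢y : ∀ i j → x i ≢ y j

      A-connected      : Connected A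
      B-connected      : Connected B
      A-B-antiComplete : AntiComplete A B

      x-y-adjacent : ∀ i → Adj (x i) (y i)
      x-A          : ∀ i → HasNeighborIn (x i) A
      x-B          : ∀ i → ¬ HasNeighborIn (x i) B
      y-B          : ∀ i → HasNeighborIn (y i) B
      y-A          : ∀ i → ¬ HasNeighborIn (y i) A

      x-y-nonadjacent : ∀ i j → i ≢ j → ¬ Adj (x i) (y j)

  CreatureFree : ℕ → Set
  CreatureFree k = ¬ Creature k

-- The constant c ranges over ℚ. This is the same notion as with real c > 1:
-- between 1 and any such real there is a rational greater than 1, and lowering
-- c only weakens the bound.
Feral : Pred Graph 0ℓ → Set
Feral F =
  ∃[ c ] 1ℚ ℚ.< c × (∀ (N₀ : ℕ) →
    ∃[ G ] F G × N₀ ℕ.< Graph.order G ×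
      (∃[ m ] (c ^ Graph.order G) ℚ.≤ (+ m / 1) × AtLeastMinimalSeparators G m))

-- The family consists of the twisted ladders: layers 0, …, K − 1 of four vertices
-- (p , q) ∈ {0,1}², where (p , q) in layer i is adjacent to (q , r) in layer i + 1.
-- Between two consecutive layers there are thus only two ports, the values of q.
--
-- Many separators: choose a port l i at every boundary i between layers.  The
-- vertices (l i , l (i + 1)) form one side, those through the opposite ports form
-- the other, and the vertices of the remaining kind, which lead from one side to
-- the other, separate the two.  Up to exchanging the sides, the choice of ports can
-- be read off the separator.
--
-- No large creature: if A and B both cross the boundary that contains the edge
-- x i – y i, then each of them occupies one port, so x i and y i both have a
-- neighbour in A or both have one in B.  Hence this boundary is not crossed by, say,
-- A, and as x i has a neighbour in A it lies next to an extreme layer of A.  Only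
-- boundedly many vertices do.

module Submission where

open import Defs
open import Algebra.Bundles using (module CommutativeRing)
open import Data.Bool.Base using (Bool; T)
open import Data.Bool.Properties using (T-≡)
open import Data.Fin.Base
  using (Fin; zero; suc; toℕ; fromℕ<; combine; remQuot; quotient; remainder; opposite;
         join; splitAt; finToFun; funToFin)
open import Data.Fin.Properties
  using (_≟_; toℕ<n; toℕ-injective; toℕ-fromℕ<; all?; ¬∀⟶∃¬; pigeonhole; remQuot-combine;
         combine-remQuot; combine-injective; funToFin-finToFin; splitAt-join)
  renaming (<⇒≢ to <ꟳ⇒≢)
open import Data.Fin.Subset using (Subset; _∈_; _∉_; _⊆_; Nonempty)
open import Data.Fin.Subset.Properties using (_∈?_)
open import Data.Integer.Base as ℤ using (+_)
open import Data.Integer.Properties using (pos-*)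
open import Data.Nat.Base using (ℕ; zero; suc; _+_; _*_; _≤_; _<_; z≤n; s≤s) renaming (_^_ to _^ℕ_)
open import Data.Nat.Properties
  using (_≤?_; ≤-reflexive; ≤-trans; ≤-antisym; ≤-pred; <⇒≤; <⇒≢; <⇒≱; ≰⇒>; n≤1+n; m≤m+n;
         m≤n+m; m≤m*n; 1+n≢n; <-cmp; ≤∧≢⇒<)
  renaming (_≟_ to _≟ℕ_)
open import Data.Product.Base using (_×_; _,_; proj₁; proj₂; ∃-syntax; Σ-syntax; uncurry; swap)
open import Data.Rational.Base as ℚ using (ℚ; 1ℚ; _/_; toℚᵘ)
open import Data.Rational.Properties as ℚ using (toℚᵘ-injective; toℚᵘ-homo-*; toℚᵘ-fromℚᵘ)
open import Data.Rational.Unnormalised.Base as ℚᵘ using (mkℚᵘ; *≡*)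
import Data.Rational.Unnormalised.Properties as ℚᵘ
open import Data.Sum.Base as Sum using (_⊎_; inj₁; inj₂; [_,_]′)
open import Data.Sum.Properties using (inj₁-injective; inj₂-injective)
open import Data.Vec.Base using (tabulate)
open import Data.Vec.Properties using (lookup∘tabulate; lookup⇒[]=; []=⇒lookup)
open import Function.Base using (_∘_)
open import Function.Bundles using (module Equivalence)
open import Level using (0ℓ)
open import Relation.Binary.Construct.Closure.ReflexiveTransitive using (Star; ε; _◅_; _◅◅_; reverse)
open import Relation.Binary.Definitions using (tri<; tri≈; tri>)
open import Relation.Binary.PropositionalEquality
  using (_≡_; _≢_; _≗_; refl; sym; trans; cong; cong₂; subst)
open import Relation.Nullary using (¬_; Dec; yes; no; isYes; contradiction)
open import Relation.Nullary.Decidable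
  using (_×-dec_; _⊎-dec_; _→-dec_; ¬?; toWitness; fromWitness; from-yes; decidable-stable)
open import Relation.Unary using (Pred; Decidable; _≐_)

-- Subsets and components

module _ {n} {P : Pred (Fin n) 0ℓ} (P? : Decidable P) where

  subset : Subset n
  subset = tabulate (isYes ∘ P?)

  ∈-subset⁺ : ∀ {v} → P v → v ∈ subset
  ∈-subset⁺ {v} Pv = lookup⇒[]= v _
    (trans (lookup∘tabulate _ v) (Equivalence.to T-≡ (fromWitness {a? = P? v} Pv)))

  ∈-subset⁻ : ∀ {v} → v ∈ subset → P v
  ∈-subset⁻ {v} v∈ = toWitness {a? = P? v}
    (Equivalence.from T-≡ (trans (sym (lookup∘tabulate _ v)) ([]=⇒lookup v∈)))

module _ (G : Graph) where
  open Graph G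

  -- Maximality comes from walking along a path of `D` that starts in `C`: as `D` avoids `S`,
  -- closedness keeps every step inside `C`.
  closed⇒component : ∀ {S C} → Disjoint G C S → Connected G C →
    (∀ {u v} → u ∈ C → Adj u v → v ∉ S → v ∈ C) →
    IsComponentOfComplement G S C
  closed⇒component {S} {C} C∩S=∅ C-conn@((c , c∈C) , _) closed = record
    { avoids = C∩S=∅ ; connected = C-conn ; maximal = maximal }
    where
    maximal : ∀ D → Disjoint G D S → Connected G D → C ⊆ D → D ⊆ C
    maximal D D∩S=∅ (_ , D-conn) C⊆D {d} d∈D = stays (D-conn c d (C⊆D c∈C) d∈D) c∈C
      where
      stays : ∀ {u v} → Star (InducedAdj G D) u v → u ∈ C → v ∈ C
      stays ε u∈C = u∈C
      stays ((_ , w∈D , uw) ◅ p) u∈C = stays p (closed u∈C uw (D∩S=∅ _ w∈D))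

-- The twisted ladder

two-values : {α β : Fin 2} → α ≢ β → ∀ p → p ≡ α ⊎ p ≡ β
two-values {zero}     {zero}     α≢β _          = contradiction refl α≢β
two-values {zero}     {suc zero} _   zero       = inj₁ refl
two-values {zero}     {suc zero} _   (suc zero) = inj₂ refl
two-values {suc zero} {zero}     _   zero       = inj₂ refl
two-values {suc zero} {zero}     _   (suc zero) = inj₁ refl
two-values {suc zero} {suc zero} α≢β _          = contradiction refl α≢β

opposite≢ : ∀ (p : Fin 2) → p ≢ opposite p
opposite≢ zero       ()
opposite≢ (suc zero) ()

parity : ℕ → Fin 2
parity zero    = zero
parity (suc n) = opposite (parity n)

parity-injective : ∀ {m n} → m ≤ suc n → n ≤ suc m → parity m ≡ parity n → m ≡ n
parity-injective {m} {n} m≤1+n n≤1+m eq with <-cmp m n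
... | tri≈ _ m≡n _ = m≡n
... | tri< m<n _ _ with refl ← ≤-antisym n≤1+m m<n = contradiction eq (opposite≢ (parity m))
... | tri> _ _ n<m with refl ← ≤-antisym m≤1+n n<m = contradiction (sym eq) (opposite≢ (parity n))

module Ladder (K : ℕ) where

  -- Abstractness keeps layer, inn, out and adjacent injective for unification.
  abstract
    layer : Fin (K * 4) → ℕ
    layer v = toℕ (quotient {K} 4 v)

    kind : Fin (K * 4) → Fin 4
    kind v = remainder {K} 4 v

    inn out : Fin (K * 4) → Fin 2
    inn v = quotient {2} 2 (kind v)
    out v = remainder {2} 2 (kind v)

    layer<K : ∀ v → layer v < K
    layer<K v = toℕ<n (quotient {K} 4 v)

    layer-kind-injective : ∀ {u v} → layer u ≡ layer v → kind u ≡ kind v → u ≡ v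
    layer-kind-injective {u} {v} eq₁ eq₂ = trans (sym (combine-remQuot {K} 4 u))
      (trans (cong₂ combine (toℕ-injective eq₁) eq₂) (combine-remQuot {K} 4 v))

    vertex : ∀ {i} → i < K → Fin 2 → Fin 2 → Fin (K * 4)
    vertex i<K p q = combine (fromℕ< i<K) (combine p q)

    remQuot-vertex : ∀ {i} (i<K : i < K) p q →
                     remQuot {K} 4 (vertex i<K p q) ≡ (fromℕ< i<K , combine p q)
    remQuot-vertex i<K p q = remQuot-combine (fromℕ< i<K) (combine p q)

    remQuot-kind : ∀ {i} (i<K : i < K) p q → remQuot {2} 2 (kind (vertex i<K p q)) ≡ (p , q)
    remQuot-kind i<K p q =
      trans (cong (remQuot {2} 2 ∘ proj₂) (remQuot-vertex i<K p q)) (remQuot-combine p q)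

    layer-vertex : ∀ {i} (i<K : i < K) p q → layer (vertex i<K p q) ≡ i
    layer-vertex i<K p q = trans (cong (toℕ ∘ proj₁) (remQuot-vertex i<K p q)) (toℕ-fromℕ< i<K)

    inn-vertex : ∀ {i} (i<K : i < K) p q → inn (vertex i<K p q) ≡ p
    inn-vertex i<K p q = cong proj₁ (remQuot-kind i<K p q)

    out-vertex : ∀ {i} (i<K : i < K) p q → out (vertex i<K p q) ≡ q
    out-vertex i<K p q = cong proj₂ (remQuot-kind i<K p q)

  Link : Fin (K * 4) → Fin (K * 4) → Set
  Link u v = suc (layer u) ≡ layer v × out u ≡ inn v

  Linked? : ∀ u v → Dec (Link u v ⊎ Link v u)
  Linked? u v = Link? u v ⊎-dec Link? v u
    where
    Link? : ∀ u v → Dec (Link u v)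
    Link? u v = (suc (layer u) ≟ℕ layer v) ×-dec (out u ≟ inn v)

  abstract
    adjacent : Fin (K * 4) → Fin (K * 4) → Bool
    adjacent u v = isYes (Linked? u v)

    links⇒adj : ∀ {u v} → Link u v ⊎ Link v u → T (adjacent u v)
    links⇒adj {u} {v} = fromWitness {a? = Linked? u v}

    adj⇒links : ∀ {u v} → T (adjacent u v) → Link u v ⊎ Link v u
    adj⇒links {u} {v} = toWitness {a? = Linked? u v}

  ladder : Graph
  ladder = record
    { order      = K * 4
    ; adj        = adjacent
    ; adj-sym    = λ uv → links⇒adj (Sum.swap (adj⇒links uv))
    ; adj-irrefl = λ v vv → [ 1+n≢n ∘ proj₁ , 1+n≢n ∘ proj₁ ]′ (adj⇒links vv)
    }

  open Graph ladder

  layer-adj : ∀ {u v} → Adj u v → layer u ≤ suc (layer v)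
  layer-adj uv with adj⇒links uv
  ... | inj₁ (eq , _) = ≤-trans (<⇒≤ (≤-reflexive eq)) (n≤1+n _)
  ... | inj₂ (eq , _) = ≤-reflexive (sym eq)

  -- Creatures

  Crosses : VertexSet → ℕ → Set
  Crosses C t = ∃[ a ] ∃[ b ] a ∈ C × b ∈ C × Link a b × layer a ≡ t

  -- A discrete intermediate value argument: an edge changes the layer by exactly one, so the first
  -- step beyond layer `t` is a link starting in layer `t`.
  path-crosses : ∀ {C t u v} → Star (InducedAdj ladder C) u v →
                 layer u ≤ t → t < layer v → Crosses C t
  path-crosses ε u≤t t<u = contradiction u≤t (<⇒≱ t<u)
  path-crosses {t = t} {u} (_◅_ {j = w} (u∈C , w∈C , uw) p) u≤t t<v with layer w ≤? t
  ... | yes w≤t = path-crosses p w≤t t<v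
  ... | no  w≰t with adj⇒links uw
  ...   | inj₁ l@(eq , _) = u , w , u∈C , w∈C , l ,
                            ≤-antisym u≤t (≤-pred (≤-trans (≰⇒> w≰t) (≤-reflexive (sym eq))))
  ...   | inj₂ (eq , _) = contradiction (≤-trans (<⇒≤ (≤-reflexive eq)) u≤t) w≰t

  Below Above Peripheral : VertexSet → Vertex → Set
  Below C z = ∀ c → c ∈ C → layer c ≤ layer z
  Above C z = ∀ c → c ∈ C → layer z ≤ layer c
  Peripheral C z = Below C z ⊎ Above C z

  -- If `C` has vertices on both sides of the boundary, a path joining them crosses it. Otherwise
  -- `C` lies on one side, which makes both ends of the link peripheral.
  peripheral-or-crosses : ∀ {C u v} → Connected ladder C → Link u v →
    (Peripheral C u × Peripheral C v) ⊎ Crosses C (layer u)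
  peripheral-or-crosses {C} {u} {v} (_ , conn) (eq , _)
    with all? (λ c → (c ∈? C) →-dec (layer c ≤? layer u))
  ... | yes below = inj₁ (inj₁ below ,
                          inj₁ λ c c∈C → ≤-trans (below c c∈C) (<⇒≤ (≤-reflexive eq)))
  ... | no ¬below with all? (λ c → (c ∈? C) →-dec (layer v ≤? layer c))
  ...   | yes above = inj₁ (inj₂ (λ c c∈C → ≤-trans (<⇒≤ (≤-reflexive eq)) (above c c∈C)) ,
                            inj₂ above)
  ...   | no ¬above = inj₂ (path-crosses (conn a b a∈C b∈C) a≤u u<b)
    where
    counterexample : {P : Pred Vertex 0ℓ} → Decidable P → ¬ (∀ c → c ∈ C → P c) →
                     ∃[ c ] c ∈ C × ¬ P c
    counterexample P? ¬P with c , ¬Pc ← ¬∀⟶∃¬ _ _ (λ c → (c ∈? C) →-dec P? c) ¬P =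
      c , decidable-stable (c ∈? C) (λ c∉C → ¬Pc (λ c∈C → contradiction c∈C c∉C)) , λ Pc → ¬Pc (λ _ → Pc)
    low  = counterexample (λ c → layer v ≤? layer c) ¬above
    high = counterexample (λ c → layer c ≤? layer u) ¬below
    a = proj₁ low
    b = proj₁ high
    a∈C = proj₁ (proj₂ low)
    b∈C = proj₁ (proj₂ high)
    a≤u : layer a ≤ layer u
    a≤u = ≤-pred (≤-trans (≰⇒> (proj₂ (proj₂ low))) (≤-reflexive (sym eq)))
    u<b : layer u < layer b
    u<b = ≰⇒> (proj₂ (proj₂ high))

  -- The links through one port form a complete bipartite graph, so `u` is also linked to `b`, and
  -- `a` to `v`.
  crossing-link : ∀ {C a b u v} → a ∈ C → b ∈ C → Link a b → layer a ≡ layer u →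
    Link u v → out u ≡ out a → HasNeighborIn ladder u C × HasNeighborIn ladder v C
  crossing-link {a = a} {b} {u} {v} a∈C b∈C (a+1≡b , ab) a≡u (u+1≡v , uv) u≡a =
    (b , b∈C , links⇒adj (inj₁ (trans (cong suc (sym a≡u)) a+1≡b , trans u≡a ab))) ,
    (a , a∈C , links⇒adj (inj₂ (trans (cong suc a≡u) u+1≡v , trans (sym u≡a) uv)))

  -- Two anti-complete sets crossing the same boundary use up both of its ports.
  crossing-both : ∀ {A B u v} → AntiComplete ladder A B → Link u v →
    Crosses A (layer u) → Crosses B (layer u) →
    (HasNeighborIn ladder u A × HasNeighborIn ladder v A) ⊎ (HasNeighborIn ladder u B × HasNeighborIn ladder v B)
  crossing-both {u = u} anti uv (a , a′ , a∈A , a′∈A , aa′ , a≡u)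
                (b , b′ , b∈B , b′∈B , bb′@(b+1≡b′ , b~b′) , b≡u) =
    Sum.map (crossing-link a∈A a′∈A aa′ a≡u uv) (crossing-link b∈B b′∈B bb′ b≡u uv)
      (two-values distinct-ports (out u))
    where
    distinct-ports : out a ≢ out b
    distinct-ports eq = anti a b′ a∈A b′∈B
      (links⇒adj (inj₁ (trans (cong suc (trans a≡u (sym b≡u))) b+1≡b′ , trans eq b~b′)))

  -- The two negations are what an edge of a creature supplies, since `y i` has no neighbour in `A`
  -- and `x i` none in `B`. They refute both outcomes of `crossing-both`.
  link-dichotomy : ∀ {A B u v} → Connected ladder A → Connected ladder B →
    AntiComplete ladder A B → Link u v →
    ¬ (HasNeighborIn ladder u A × HasNeighborIn ladder v A) →
    ¬ (HasNeighborIn ladder u B × HasNeighborIn ladder v B) →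
    (Peripheral A u × Peripheral A v) ⊎ (Peripheral B u × Peripheral B v)
  link-dichotomy A-conn B-conn anti uv ¬A ¬B
    with peripheral-or-crosses A-conn uv | peripheral-or-crosses B-conn uv
  ... | inj₁ perA   | _           = inj₁ perA
  ... | inj₂ _      | inj₁ perB   = inj₂ perB
  ... | inj₂ crossA | inj₂ crossB = contradiction (crossing-both anti uv crossA crossB) [ ¬A , ¬B ]′

  direction : ∀ {C z} → Peripheral C z → Fin 2
  direction (inj₁ _) = zero
  direction (inj₂ _) = suc zero

  code : ∀ {C z} → Peripheral C z → Fin 16
  code {z = z} per = combine {2} {8} (direction per)
                             (combine {2} {4} (parity (layer z)) (kind z))

  -- A vertex with a neighbour in C is within distance one of the layer of the
  -- extreme vertices of C, so that the parity of its layer determines its layer.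
  code-injective : ∀ {C z z′} → HasNeighborIn ladder z C → HasNeighborIn ladder z′ C →
    (per : Peripheral C z) (per′ : Peripheral C z′) → code per ≡ code per′ → z ≡ z′
  code-injective {C} {z} {z′} (c , c∈C , zc) (c′ , c′∈C , z′c′) per per′ eq
    with dir≡ , eq′ ← combine-injective {2} {8} _ _ _ _ eq
    with parity≡ , kind≡ ← combine-injective {2} {4} _ _ _ _ eq′ =
    layer-kind-injective (uncurry parity-injective (close per per′ dir≡) parity≡) kind≡
    where
    close : (per : Peripheral C z) (per′ : Peripheral C z′) →
            direction per ≡ direction per′ →
            layer z ≤ suc (layer z′) × layer z′ ≤ suc (layer z)
    close (inj₁ below) (inj₁ below′) _ =
      ≤-trans (layer-adj zc) (s≤s (below′ c c∈C)) , ≤-trans (layer-adj z′c′) (s≤s (below c′ c′∈C))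
    close (inj₂ above) (inj₂ above′) _ =
      ≤-trans (above c′ c′∈C) (layer-adj (adj-sym z′c′)) , ≤-trans (above′ c c∈C) (layer-adj (adj-sym zc))

  -- The bound is 32 = 2 * 16: the choice between `A` and `B`, then 2 directions, 2 parities and 4
  -- kinds.
  ladder-creatureFree : ∀ {k} → 32 < k → CreatureFree ladder k
  ladder-creatureFree {k} 32<k creature =
    let i , j , i<j , eq = pigeonhole 32<k index
    in contradiction (index-injective eq) (<ꟳ⇒≢ i<j)
    where
    open Creature creature

    -- `x i` is kept for `A` and `y i` for `B`, because these are the ends with a neighbour in the
    -- respective set, as `code-injective` demands.
    end : ∀ i → Peripheral A (x i) ⊎ Peripheral B (y i)
    end i with adj⇒links (x-y-adjacent i)
    ... | inj₁ xy = Sum.map proj₁ proj₂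
      (link-dichotomy A-connected B-connected A-B-antiComplete xy (y-A i ∘ proj₂) (x-B i ∘ proj₁))
    ... | inj₂ yx = Sum.map proj₂ proj₁
      (link-dichotomy A-connected B-connected A-B-antiComplete yx (y-A i ∘ proj₁) (x-B i ∘ proj₂))

    index : Fin k → Fin 32
    index i = join 16 16 (Sum.map code code (end i))

    end-injective : ∀ {i j} → Sum.map code code (end i) ≡ Sum.map code code (end j) → i ≡ j
    end-injective {i} {j} eq with end i | end j
    ... | inj₁ _ | inj₂ _ = contradiction eq λ ()
    ... | inj₂ _ | inj₁ _ = contradiction eq λ ()
    ... | inj₁ p | inj₁ q = x-injective (code-injective (x-A i) (x-A j) p q (inj₁-injective eq))
    ... | inj₂ p | inj₂ q = y-injective (code-injective (y-B i) (y-B j) p q (inj₂-injective eq))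

    index-injective : ∀ {i j} → index i ≡ index j → i ≡ j
    index-injective {i} {j} eq = end-injective
      (trans (sym (splitAt-join 16 16 (Sum.map code code (end i))))
             (trans (cong (splitAt 16) eq) (splitAt-join 16 16 (Sum.map code code (end j)))))

  -- Minimal separators

  -- The ends have no boundary on one side, so there that port is unconstrained.
  Side : (ℕ → Fin 2) → Vertex → Set
  Side l v = (layer v ≡ 0 ⊎ inn v ≡ l (layer v)) × (suc (layer v) ≡ K ⊎ out v ≡ l (suc (layer v)))

  Side? : ∀ l → Decidable (Side l)
  Side? l v = ((layer v ≟ℕ 0) ⊎-dec (inn v ≟ l (layer v))) ×-dec
              ((suc (layer v) ≟ℕ K) ⊎-dec (out v ≟ l (suc (layer v))))

  Opposite : (l r : ℕ → Fin 2) → Set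
  Opposite l r = ∀ i → l i ≢ r i

  spine : (l : ℕ → Fin 2) → ∀ {i} → i < K → Vertex
  spine l {i} i<K = vertex i<K (l i) (l (suc i))

  spine-side : ∀ l {i} (i<K : i < K) → Side l (spine l i<K)
  spine-side l i<K =
    inj₂ (trans (inn-vertex i<K _ _) (cong l (sym (layer-vertex i<K _ _)))) ,
    inj₂ (trans (out-vertex i<K _ _) (cong (l ∘ suc) (sym (layer-vertex i<K _ _))))

  spine-linkˡ : ∀ l {i v} (i<K : i < K) → suc i ≡ layer v → inn v ≡ l (suc i) → Link (spine l i<K) v
  spine-linkˡ l i<K i+1≡v inn≡ =
    trans (cong suc (layer-vertex i<K _ _)) i+1≡v , trans (out-vertex i<K _ _) (sym inn≡)

  spine-linkʳ : ∀ l {i v} (i<K : i < K) → suc (layer v) ≡ i → out v ≡ l i → Link v (spine l i<K)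
  spine-linkʳ l i<K v+1≡i out≡ =
    trans v+1≡i (sym (layer-vertex i<K _ _)) , trans out≡ (sym (inn-vertex i<K _ _))

  side-inn : ∀ l {v i} → Side l v → layer v ≡ suc i → inn v ≡ l (suc i)
  side-inn l (inj₁ v≡0 , _) v≡1+i = contradiction (trans (sym v≡0) v≡1+i) λ ()
  side-inn l (inj₂ inn≡ , _) v≡1+i = trans inn≡ (cong l v≡1+i)

  side-out : ∀ l {v i} → Side l v → suc (layer v) ≡ i → i < K → out v ≡ l i
  side-out l (_ , inj₁ v+1≡K) v+1≡i i<K = contradiction (trans (sym v+1≡i) v+1≡K) (<⇒≢ i<K)
  side-out l (_ , inj₂ out≡)  v+1≡i _   = trans out≡ (cong l v+1≡i)

  -- A link passes an inner boundary, where the exemptions for the end layers do not apply: its port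
  -- would have to be the value of both `l` and `r`.
  sides-unlinked : ∀ {l r u v} → Opposite l r → Side l u → Side r v → ¬ Link u v
  sides-unlinked {l} {r} {v = v} l≢r lu rv (u+1≡v , out≡inn) = l≢r _
    (trans (sym (side-out l lu u+1≡v (layer<K v))) (trans out≡inn
      (trans (side-inn r rv (sym u+1≡v)) (cong r u+1≡v))))

  sides-nonadjacent : ∀ {l r u v} → Opposite l r → Side l u → Side r v → ¬ Adj u v
  sides-nonadjacent l≢r lu rv uv =
    [ sides-unlinked l≢r lu rv , sides-unlinked (λ i → l≢r i ∘ sym) rv lu ]′ (adj⇒links uv)

  -- A vertex on neither side has one port from `l` and one from `r`, and through the former it
  -- meets the spine of `l`. In an end layer a single port is constrained, so every vertex there is
  -- on a side.
  between-neighbor : ∀ {l r v} → Opposite l r → ¬ Side l v → ¬ Side r v → ∃[ u ] Side l u × Adj u v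
  between-neighbor {l} {r} {v} l≢r ¬l ¬r = go (layer v) refl
    where
    inn-cases = two-values (l≢r (layer v)) (inn v)
    out-cases = two-values (l≢r (suc (layer v))) (out v)

    above : suc (layer v) ≢ K → out v ≡ l (suc (layer v)) → ∃[ u ] Side l u × Adj u v
    above v+1≢K out≡ =
      spine l v+1<K , spine-side l v+1<K ,
      links⇒adj (inj₂ (spine-linkʳ l v+1<K refl out≡))
      where
      v+1<K : suc (layer v) < K
      v+1<K = ≤∧≢⇒< (layer<K v) v+1≢K

    go : ∀ i → layer v ≡ i → ∃[ u ] Side l u × Adj u v
    go zero v≡0 =
      [ (λ out≡l → contradiction (inj₁ v≡0 , inj₂ out≡l) ¬l)
      , (λ out≡r → contradiction (inj₁ v≡0 , inj₂ out≡r) ¬r) ]′ out-cases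
    go (suc i) v≡1+i with inn-cases
    ... | inj₁ inn≡l =
      spine l i<K , spine-side l i<K ,
      links⇒adj (inj₁ (spine-linkˡ l i<K (sym v≡1+i) (trans inn≡l (cong l v≡1+i))))
      where
      i<K : i < K
      i<K = ≤-trans (≤-trans (n≤1+n _) (≤-reflexive (cong suc (sym v≡1+i)))) (layer<K v)
    ... | inj₂ inn≡r with out-cases
    ...   | inj₁ out≡l = above (λ v+1≡K → ¬r (inj₂ inn≡r , inj₁ v+1≡K)) out≡l
    ...   | inj₂ out≡r = contradiction (inj₂ inn≡r , inj₂ out≡r) ¬r

  side : (ℕ → Fin 2) → VertexSet
  side l = subset (Side? l)

  Between? : ∀ l r → Decidable (λ v → ¬ Side l v × ¬ Side r v)
  Between? l r v = ¬? (Side? l v) ×-dec ¬? (Side? r v)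

  between : (l r : ℕ → Fin 2) → VertexSet
  between l r = subset (Between? l r)

  side-connected : 2 ≤ K → ∀ l → Connected ladder (side l)
  side-connected 2≤K l = (_ , start∈) , λ u v u∈ v∈ → to-start u∈ ◅◅ reverse flip (to-start v∈)
    where
    0<K : 0 < K
    0<K = ≤-trans (s≤s z≤n) 2≤K

    spine∈ : ∀ {i} (i<K : i < K) → spine l i<K ∈ side l
    spine∈ i<K = ∈-subset⁺ (Side? l) (spine-side l i<K)

    start∈ = spine∈ 0<K

    flip : ∀ {u v} → InducedAdj ladder (side l) u v → InducedAdj ladder (side l) v u
    flip (u∈ , v∈ , uv) = v∈ , u∈ , adj-sym uv

    descend : ∀ i {v} → layer v ≡ i → v ∈ side l →
              Star (InducedAdj ladder (side l)) v (spine l 0<K)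
    -- Layer 0 contains two vertices of the side, as their `inn` is free. They are not adjacent but
    -- meet at the spine vertex of layer 1.
    descend zero {v} v≡0 v∈ =
      (v∈ , spine∈ 2≤K , links⇒adj (inj₁ (spine-linkʳ l 2≤K (cong suc v≡0)
        (side-out l (∈-subset⁻ (Side? l) v∈) (cong suc v≡0) 2≤K)))) ◅
      (spine∈ 2≤K , start∈ , links⇒adj (inj₂ (spine-linkˡ l 0<K (sym (layer-vertex 2≤K _ _))
        (inn-vertex 2≤K _ _)))) ◅ ε
    descend (suc i) {v} v≡1+i v∈ =
      (v∈ , spine∈ i<K , links⇒adj (inj₂ (spine-linkˡ l i<K (sym v≡1+i)
        (side-inn l (∈-subset⁻ (Side? l) v∈) v≡1+i)))) ◅
      descend i (layer-vertex i<K _ _) (spine∈ i<K)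
      where
      i<K : i < K
      i<K = ≤-trans (≤-trans (n≤1+n _) (≤-reflexive (cong suc (sym v≡1+i)))) (layer<K v)

    to-start : ∀ {v} → v ∈ side l → Star (InducedAdj ladder (side l)) v (spine l 0<K)
    to-start = descend _ refl

  module _ (3≤K : 3 ≤ K) where
    private
      1<K : 1 < K
      1<K = ≤-trans (s≤s (s≤s z≤n)) 3≤K
      0<K : 0 < K
      0<K = ≤-trans (s≤s z≤n) 3≤K

    spine∉opposite : ∀ {l r i} → Opposite l r → suc i < K → (i<K : i < K) → ¬ Side r (spine l i<K)
    spine∉opposite {r = r} l≢r i+1<K i<K rv = l≢r _
      (trans (sym (out-vertex i<K _ _)) (side-out r rv (cong suc (layer-vertex i<K _ _)) i+1<K))

    between-nonempty : ∀ {l r} → Opposite l r → Nonempty (between l r)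
    between-nonempty {l} {r} l≢r = v , ∈-subset⁺ (Between? l r)
      ( (λ lv → l≢r 2 (trans (sym (side-out l lv v+1≡2 3≤K)) (out-vertex 1<K _ _)))
      , (λ rv → l≢r 1 (trans (sym (inn-vertex 1<K _ _)) (side-inn r rv (layer-vertex 1<K _ _)))))
      where
      -- A vertex that switches from `l` to `r`. Layer 1 has an inner boundary on either side
      -- because `3 ≤ K`.
      v = vertex 1<K (l 1) (r 2)
      v+1≡2 : suc (layer v) ≡ 2
      v+1≡2 = cong suc (layer-vertex 1<K _ _)

    -- The separator enters only through its membership rules, which are symmetric in `l` and `r`;
    -- the same proofs thus serve both sides of `between l r`.
    module _ {l r S} (l≢r : Opposite l r)
             (S⁺ : ∀ {v} → ¬ Side l v → ¬ Side r v → v ∈ S)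
             (S⁻ : ∀ {v} → v ∈ S → ¬ Side l v × ¬ Side r v) where

      side-component : IsComponentOfComplement ladder S (side l)
      side-component = closed⇒component ladder
        (λ v v∈l v∈S → proj₁ (S⁻ v∈S) (∈-subset⁻ (Side? l) v∈l))
        (side-connected 1<K l)
        λ {u} {v} u∈l uv v∉S → ∈-subset⁺ (Side? l) (decidable-stable (Side? l v)
          λ ¬lv → v∉S (S⁺ ¬lv λ rv → sides-nonadjacent l≢r (∈-subset⁻ (Side? l) u∈l) rv uv))

      side-neighborhood : N ladder (side l) ≐ (_∈ S)
      side-neighborhood =
        (λ (v∉l , u , u∈l , uv) → S⁺ (v∉l ∘ ∈-subset⁺ (Side? l))
          λ rv → sides-nonadjacent l≢r (∈-subset⁻ (Side? l) u∈l) rv uv) ,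
        λ v∈S → let u , lu , uv = between-neighbor l≢r (proj₁ (S⁻ v∈S)) (proj₂ (S⁻ v∈S))
                in proj₁ (S⁻ v∈S) ∘ ∈-subset⁻ (Side? l) , u , ∈-subset⁺ (Side? l) lu , uv

    between-minimalSeparator : ∀ {l r} → Opposite l r → IsMinimalSeparator ladder (between l r)
    between-minimalSeparator {l} {r} l≢r = record
      { nonempty    = between-nonempty l≢r
      ; L           = side l
      ; R           = side r
      ; L-component = side-component l≢r S⁺ S⁻
      ; R-component = side-component r≢l (λ ¬r ¬l → S⁺ ¬l ¬r) (swap ∘ S⁻)
      ; L≢R         = λ L≡R → spine∉opposite l≢r 1<K 0<K (∈-subset⁻ (Side? r)
                        (subst (spine l 0<K ∈_) L≡R (∈-subset⁺ (Side? l) (spine-side l 0<K))))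
      ; N[L]≐S      = side-neighborhood l≢r S⁺ S⁻
      ; N[R]≐S      = side-neighborhood r≢l (λ ¬r ¬l → S⁺ ¬l ¬r) (swap ∘ S⁻)
      }
      where
      r≢l : Opposite r l
      r≢l i = l≢r i ∘ sym
      S⁺ : ∀ {v} → ¬ Side l v → ¬ Side r v → v ∈ between l r
      S⁺ ¬l ¬r = ∈-subset⁺ (Between? l r) (¬l , ¬r)
      S⁻ : ∀ {v} → v ∈ between l r → ¬ Side l v × ¬ Side r v
      S⁻ = ∈-subset⁻ (Between? l r)

  -- Induction along the boundaries. The spine vertex of `l` in layer `i + 1` is outside the common
  -- separator, hence on side `l′` or `r′`. Its `inn`, known by induction, excludes `r′`, and then
  -- its `out` gives the next label.
  between-injective : ∀ {l r l′ r′} → Opposite l r → Opposite l′ r′ → l 1 ≡ l′ 1 →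
    between l r ≡ between l′ r′ → ∀ i → suc i < K → l (suc i) ≡ l′ (suc i)
  between-injective _ _ l₁≡l′₁ _ zero _ = l₁≡l′₁
  between-injective {l} {r} {l′} {r′} l≢r l′≢r′ l₁≡l′₁ S≡S′ (suc i) i+2<K
    with l≡l′ ← between-injective l≢r l′≢r′ l₁≡l′₁ S≡S′ i (<⇒≤ i+2<K) = agree (Side? l′ v) (Side? r′ v)
    where
    i+1<K : suc i < K
    i+1<K = <⇒≤ i+2<K
    v = spine l i+1<K
    v+1≡i+2 : suc (layer v) ≡ suc (suc i)
    v+1≡i+2 = cong suc (layer-vertex i+1<K _ _)

    agree : Dec (Side l′ v) → Dec (Side r′ v) → l (suc (suc i)) ≡ l′ (suc (suc i))
    agree (yes l′v) _ = trans (sym (out-vertex i+1<K _ _)) (side-out l′ l′v v+1≡i+2 i+2<K)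
    agree (no _) (yes r′v) = contradiction
      (trans (sym l≡l′) (trans (sym (inn-vertex i+1<K _ _)) (side-inn r′ r′v (layer-vertex i+1<K _ _))))
      (l′≢r′ (suc i))
    agree (no ¬l′) (no ¬r′) = contradiction (spine-side l i+1<K) (proj₁ (∈-subset⁻ (Between? l r)
      (subst (v ∈_) (sym S≡S′) (∈-subset⁺ (Between? l′ r′) (¬l′ , ¬r′)))))

open Ladder using (ladder; ladder-creatureFree; between; between-injective; between-minimalSeparator)

-- Counting

funToFin-cong : ∀ {m n} {f g : Fin m → Fin n} → f ≗ g → funToFin f ≡ funToFin g
funToFin-cong {zero}  _   = refl
funToFin-cong {suc m} f≗g = cong₂ combine (f≗g zero) (funToFin-cong (f≗g ∘ suc))

finToFun-injective : ∀ {m n} {a b : Fin (n ^ℕ m)} → finToFun {n} {m} a ≗ finToFun {n} {m} b → a ≡ b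
finToFun-injective {m} {n} {a} {b} eq =
  trans (sym (funToFin-finToFin {m} {n} a)) (trans (funToFin-cong eq) (funToFin-finToFin {m} {n} b))

extend : ∀ {m} → (Fin m → Fin 2) → ℕ → Fin 2
extend {zero}  f _       = zero
extend {suc m} f zero    = f zero
extend {suc m} f (suc i) = extend (f ∘ suc) i

extend-toℕ : ∀ {m} (f : Fin m → Fin 2) i → extend f (toℕ i) ≡ f i
extend-toℕ f zero    = refl
extend-toℕ f (suc i) = extend-toℕ (f ∘ suc) i

-- Complementing all labels yields the same separator, so the label at boundary 1
-- is fixed.  Boundary 0 does not exist.
labels : ∀ {m} → (Fin m → Fin 2) → ℕ → Fin 2
labels f (suc (suc i)) = extend f i
labels f _             = zero

-- The inner boundaries are 1 to `m + 2`. With the label at 1 fixed, `m + 1` free binary labels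
-- remain.
ladder-separators : ∀ m → AtLeastMinimalSeparators (ladder (3 + m)) (2 ^ℕ suc m)
ladder-separators m = separator , injective , λ a → between-minimalSeparator (3 + m) (m≤m+n 3 m) (flips a)
  where
  l : Fin (2 ^ℕ suc m) → ℕ → Fin 2
  l a = labels (finToFun {2} {suc m} a)

  flips : ∀ a i → l a i ≢ opposite (l a i)
  flips a i = opposite≢ (l a i)

  separator : Fin (2 ^ℕ suc m) → Subset ((3 + m) * 4)
  separator a = between (3 + m) (l a) (opposite ∘ l a)

  injective : ∀ {a b} → separator a ≡ separator b → a ≡ b
  injective {a} {b} eq = finToFun-injective {suc m} {2} λ i →
    trans (sym (extend-toℕ (finToFun a) i))
      -- Coordinate `i` is the label at boundary `i + 2`, and `refl` compares the fixed labels at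
      -- boundary 1.
      (trans (between-injective (3 + m) (flips a) (flips b) refl eq (suc (toℕ i)) (s≤s (s≤s (toℕ<n i))))
             (extend-toℕ (finToFun b) i))

-- Exponential growth rate

/1-homo-* : ∀ m n → + (m * n) / 1 ≡ (+ m / 1) ℚ.* (+ n / 1)
/1-homo-* m n = toℚᵘ-injective (begin
  toℚᵘ (+ (m * n) / 1)                ≈⟨ toℚᵘ-fromℚᵘ (mkℚᵘ (+ (m * n)) 0) ⟩
  mkℚᵘ (+ (m * n)) 0                  ≈⟨ *≡* (cong (ℤ._* + 1) (pos-* m n)) ⟩
  mkℚᵘ (+ m) 0 ℚᵘ.* mkℚᵘ (+ n) 0      ≈⟨ ℚᵘ.*-cong (toℚᵘ-fromℚᵘ (mkℚᵘ (+ m) 0))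
                                                   (toℚᵘ-fromℚᵘ (mkℚᵘ (+ n) 0)) ⟨
  toℚᵘ (+ m / 1) ℚᵘ.* toℚᵘ (+ n / 1)  ≈⟨ toℚᵘ-homo-* (+ m / 1) (+ n / 1) ⟨
  toℚᵘ ((+ m / 1) ℚ.* (+ n / 1))      ∎)
  where open import Relation.Binary.Reasoning.Setoid ℚᵘ.≃-setoid

-- A further layer adds four vertices and doubles the count, so the induction needs `growth ^ 4` to
-- be at most 2; the base case needs `growth ^ 16` to be at most 4.
growth : ℚ
growth = + 17 / 16

-- The start is at four layers because three are too few for this constant: `growth ^ 12` exceeds 2.
growth-bound : ∀ m → growth ^ ((4 + m) * 4) ℚ.≤ + (2 ^ℕ (2 + m)) / 1
growth-bound zero    = from-yes (growth ^ 16 ℚ.≤? + 4 / 1)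
growth-bound (suc m) = begin
  growth ^ ((5 + m) * 4)                 ≡⟨ ^-homo-* growth 4 ((4 + m) * 4) ⟩
  growth ^ 4 ℚ.* growth ^ ((4 + m) * 4)  ≤⟨ ℚ.*-monoˡ-≤-nonNeg (growth ^ 4) (growth-bound m) ⟩
  growth ^ 4 ℚ.* p                       ≤⟨ ℚ.*-monoʳ-≤-nonNeg p {{p≥0}} (from-yes (growth ^ 4 ℚ.≤? + 2 / 1)) ⟩
  (+ 2 / 1) ℚ.* p                        ≡⟨ /1-homo-* 2 (2 ^ℕ (2 + m)) ⟨
  + (2 ^ℕ (3 + m)) / 1                   ∎
  where
  open ℚ.≤-Reasoning
  open import Algebra.Properties.Semiring.Exp
    (CommutativeRing.semiring ℚ.+-*-commutativeRing) using (^-homo-*)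
  p = + (2 ^ℕ (2 + m)) / 1
  p≥0 = ℚ.normalize-nonNeg (2 ^ℕ (2 + m)) 1

mainTheorem6 : Σ[ F ∈ Pred Graph 0ℓ ] Feral F × (∀ (G : Graph) → F G → CreatureFree G 100)
mainTheorem6 = IsLadder , feral , λ { _ (K , refl) → ladder-creatureFree K (from-yes (33 ≤? 100)) }
  where
  IsLadder : Pred Graph 0ℓ
  IsLadder G = ∃[ K ] G ≡ ladder K

  feral : Feral IsLadder
  feral = growth , from-yes (1ℚ ℚ.<? growth) , λ m →
    ladder (4 + m) , (4 + m , refl) , ≤-trans (s≤s (m≤n+m m 3)) (m≤m*n (4 + m) 4) ,
    2 ^ℕ (2 + m) , growth-bound m , ladder-separators (suc m)
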